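{- Let $H_1$ and $H_2$ be two hypergraphs with disjoint vertex sets. Then the outcome $o(H_1\cup H_2)$ is determined by $o(H_1)$ and $o(H_2)$ as follows: \begin{itemize} \item if $o(H_1)=\mathcal{A}$ then $o(H_1\cup H_2)=o(H_2)$, and if $o(H_2)=\mathcal{A}$ then $o(H_1\cup H_2)=o(H_1)$; \item if $o(H_1)=o(H_2)=\mathcal{SL}$ then $o(H_1\cup H_2)=\mathcal{E}$; \item if $o(H_1)=\mathcal{E}$ or $o(H_2)=\mathcal{E}$ then $o(H_1\cup H_2)=\mathcal{E}$. \end{itemize}
   Context: A hypergraph $H$ has a finite vertex set $V(H)$ and an edge set $E(H)\subseteq 2^{V(H)}$ (the empty edge is allowed). In the Avoider-Enforcer game on $H$, two players, Avoider and Enforcer, alternately pick one previously unpicked vertex of $H$ until all vertices have been picked. Enforcer wins if at the end Avoider has picked all the vertices of some edge of $H$; otherwise Avoider wins (in particular Enforcer wins if $\varnothing\in E(H)$). The last player is the player who makes the last move of the game: this is the first player if $|V(H)|$ is odd and the second player if $|V(H)|$ is even; the other player is the second-to-last player. A player "wins on $H$ as last (resp. second-to-last) player" if that player has a winning strategy when they are the last (resp. second-to-last) player. The outcome $o(H)$ is: $\mathcal{A}$ if Avoider wins on $H$ both as last player and as second-to-last player; $\mathcal{E}$ if Enforcer wins on $H$ both as last player and as second-to-last player; $\mathcal{SL}$ if whichever player is second-to-last wins (Avoider wins as second-to-last player and Enforcer wins as second-to-last player). These are the only three possibilities. The union $H_1\cup H_2$ has vertex set $V(H_1)\cup V(H_2)$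 and edge set $E(H_1)\cup E(H_2)$. -}

module Defs where

open import Data.Bool using (true; false)
open import Data.Fin using (Fin; zero; suc; _≟_)
open import Data.Fin.Subset
  using (Subset; ⊥; ⁅_⁆; _∈_; _⊆_; _∪_; _-_; ∣_∣; Nonempty; Empty)
open import Data.Fin.Subset.Properties
  using (_⊆?_; nonempty?; ⊆-refl; p⊆p∪q; q⊆p∪q; x∈p∪q⁺; x∈p∪q⁻; p─⊥≡p; p─q⊆p;
         p─x─y≡p─y─x; x∈p∧x≢y⇒x∈p-y; x∈p⇒∣p-x∣<∣p∣; Empty-unique; ∣⊥∣≡0)
open import Data.List using (List; _++_)
open import Data.List.Relation.Unary.All as All using (All)
open import Data.List.Relation.Unary.All.Properties using (++⁺)
open import Data.List.Relation.Unary.Any as Any using (Any)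
open import Data.Nat using (ℕ; suc; _<_; parity)
open import Data.Nat.Induction using (Acc; acc; <-wellFounded)
open import Data.Parity.Base using (Parity; 0ℙ; 1ℙ; _⁻¹)
open import Data.Parity.Properties using (suc-homo-⁻¹)
open import Data.Product using (∃; ∃!; _×_; _,_; proj₁)
open import Data.Sum as Sum using (_⊎_; inj₁; inj₂)
open import Data.Vec using ([]; _∷_; here; there)
open import Function using (_∘_)
open import Relation.Binary.PropositionalEquality
  using (_≡_; _≢_; refl; sym; trans; cong)
open import Relation.Nullary using (¬_; yes; no; contradiction)

private
  variable
    n : ℕ

-- Vertices are drawn from an ambient set Fin n, of which the vertex set is an
-- arbitrary subset; hence hypergraphs over the same n may have disjoint,
-- overlapping or equal vertex sets. The list of edges stands for the set of
-- its members: order and repetition play no role in the game.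
record Hypergraph (n : ℕ) : Set where
  field
    vertices : Subset n
    edges    : List (Subset n)
    edges⊆   : All (_⊆ vertices) edges

open Hypergraph public

infixr 6 _∪ᴴ_

_∪ᴴ_ : Hypergraph n → Hypergraph n → Hypergraph n
(H₁ ∪ᴴ H₂) .vertices = vertices H₁ ∪ vertices H₂
(H₁ ∪ᴴ H₂) .edges    = edges H₁ ++ edges H₂
(H₁ ∪ᴴ H₂) .edges⊆   =
  ++⁺ (widen (p⊆p∪q (vertices H₂)) (edges⊆ H₁))
      (widen (q⊆p∪q (vertices H₁) (vertices H₂)) (edges⊆ H₂))
  where
  widen : ∀ {p q : Subset _} {es} → p ⊆ q → All (_⊆ p) es → All (_⊆ q) es
  widen {p} {q} p⊆q = All.map {P = _⊆ p} {Q = _⊆ q} λ e⊆p → p⊆q ∘ e⊆p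

data Player : Set where
  avoider enforcer : Player

opponent : Player → Player
opponent avoider  = enforcer
opponent enforcer = avoider

-- A position consists of the player to move, the set U of unpicked vertices
-- and the set A of vertices picked by Avoider.

pick : Player → Fin n → Subset n → Subset n
pick avoider  v A = A ∪ ⁅ v ⁆
pick enforcer v A = A

WonBy : Player → Hypergraph n → (A : Subset n) → Set
WonBy enforcer H A = Any (_⊆ A) (edges H)
WonBy avoider  H A = ¬ Any (_⊆ A) (edges H)

-- Strategies as trees: an element of WinningStrategy H p m U A prescribes a
-- move for p at every position where p is to move that can arise from
-- (m , U , A), and every play that follows it is won by p.
data WinningStrategy (H : Hypergraph n) (p : Player) :
                     Player → Subset n → Subset n → Set where
  end   : ∀ {m U A} → Empty U → WonBy p H A → WinningStrategy H p m U A
  move  : ∀ {U A} v → v ∈ U →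
          WinningStrategy H p (opponent p) (U - v) (pick p v A) →
          WinningStrategy H p p U A
  reply : ∀ {U A} → Nonempty U →
          (∀ v → v ∈ U →
             WinningStrategy H p p (U - v) (pick (opponent p) v A)) →
          WinningStrategy H p (opponent p) U A

WinsStarting : (first p : Player) → Hypergraph n → Set
WinsStarting first p H = WinningStrategy H p first (vertices H) ⊥

lastMover : Parity → (first : Player) → Player
lastMover 1ℙ first = first
lastMover 0ℙ first = opponent first

lastPlayer : Hypergraph n → (first : Player) → Player
lastPlayer H = lastMover (parity ∣ vertices H ∣)

-- lastPlayer H is a bijection, so exactly one choice of the first player is
-- concerned in each of the following.

WinsAsLast : Player → Hypergraph n → Set
WinsAsLast p H = ∃ λ first → lastPlayer H first ≡ p × WinsStarting first p H

WinsAsSecondToLast : Player → Hypergraph n → Set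
WinsAsSecondToLast p H =
  ∃ λ first → lastPlayer H first ≡ opponent p × WinsStarting first p H

data Outcome : Set where
  𝒜 ℰ 𝒮ℒ : Outcome

HasOutcome : Hypergraph n → Outcome → Set
HasOutcome H 𝒜  = WinsAsLast avoider H × WinsAsSecondToLast avoider H
HasOutcome H ℰ  = WinsAsLast enforcer H × WinsAsSecondToLast enforcer H
HasOutcome H 𝒮ℒ = WinsAsSecondToLast avoider H × WinsAsSecondToLast enforcer H

-- The remainder shows that every hypergraph has exactly one outcome.

∣p∣≡1+∣p-x∣ : ∀ {p : Subset n} {x} → x ∈ p → ∣ p ∣ ≡ suc ∣ p - x ∣
∣p∣≡1+∣p-x∣ {p = _ ∷ p}     here        = cong suc (sym (cong ∣_∣ (p─⊥≡p p)))
∣p∣≡1+∣p-x∣ {p = true  ∷ p} (there x∈p) = cong suc (∣p∣≡1+∣p-x∣ x∈p)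
∣p∣≡1+∣p-x∣ {p = false ∷ p} (there x∈p) = ∣p∣≡1+∣p-x∣ x∈p

parity-pick : ∀ {U : Subset n} {v} → v ∈ U → parity ∣ U - v ∣ ≡ parity ∣ U ∣ ⁻¹
parity-pick {U = U} {v} v∈U =
  trans (sym (suc-homo-⁻¹ ∣ U - v ∣)) (cong (_⁻¹ ∘ parity) (sym (∣p∣≡1+∣p-x∣ v∈U)))

odd⇒¬Empty : ∀ {U : Subset n} → parity ∣ U ∣ ≡ 1ℙ → ¬ Empty U
odd⇒¬Empty {n} odd empty with refl ← Empty-unique empty
  with () ← trans (sym odd) (cong parity (∣⊥∣≡0 n))

y∈p-x⇒y≢x : ∀ {p : Subset n} {x y} → y ∈ p - x → y ≢ x
y∈p-x⇒y≢x {p = true  ∷ p} {zero} () refl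
y∈p-x⇒y≢x {p = false ∷ p} {zero} () refl
y∈p-x⇒y≢x {p = _ ∷ p} {suc x} (there y∈) refl = y∈p-x⇒y≢x y∈ refl

∪⁅⁆-mono : ∀ {A B : Subset n} v → A ⊆ B → A ∪ ⁅ v ⁆ ⊆ B ∪ ⁅ v ⁆
∪⁅⁆-mono {A = A} v A⊆B = x∈p∪q⁺ ∘ Sum.map₁ A⊆B ∘ x∈p∪q⁻ A ⁅ v ⁆

search : ∀ {P Q : Fin n → Set} U → (∀ v → v ∈ U → P v ⊎ Q v) →
         (∃ λ v → v ∈ U × P v) ⊎ (∀ v → v ∈ U → Q v)
search []          f = inj₂ λ _ ()
search (false ∷ U) f with search U (λ v v∈U → f (suc v) (there v∈U))
... | inj₁ (v , v∈U , Pv) = inj₁ (suc v , there v∈U , Pv)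
... | inj₂ Q              = inj₂ λ { (suc v) (there v∈U) → Q v v∈U }
search (true ∷ U) f with f zero here | search U (λ v v∈U → f (suc v) (there v∈U))
... | inj₁ P₀ | _                     = inj₁ (zero , here , P₀)
... | inj₂ _  | inj₁ (v , v∈U , Pv)   = inj₁ (suc v , there v∈U , Pv)
... | inj₂ Q₀ | inj₂ Q                =
  inj₂ λ { zero here → Q₀ ; (suc v) (there v∈U) → Q v v∈U }

even⇒last : ∀ {q} → q ≡ 0ℙ → lastMover q enforcer ≡ avoider
even⇒last refl = refl

last⇒even : ∀ {q} → lastMover q enforcer ≡ avoider → q ≡ 0ℙ
last⇒even {0ℙ} _ = refl

last⇒odd : ∀ {q} → lastMover q avoider ≡ avoider → q ≡ 1ℙ
last⇒odd {1ℙ} _ = refl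

alternate : ∀ {U : Subset n} {v l} m → v ∈ U → lastMover (parity ∣ U ∣) m ≡ l →
            lastMover (parity ∣ U - v ∣) (opponent m) ≡ l
alternate {U = U} m v∈U last
  rewrite parity-pick v∈U = trans (flip (parity ∣ U ∣) m) last
  where
  flip : ∀ q m → lastMover (q ⁻¹) (opponent m) ≡ lastMover q m
  flip 0ℙ _        = refl
  flip 1ℙ avoider  = refl
  flip 1ℙ enforcer = refl

opposite : ∀ q {f l} → lastMover q f ≡ l → lastMover q (opponent f) ≡ opponent l
opposite 0ℙ refl = refl
opposite 1ℙ refl = refl

first : ∀ q l → ∃ λ f → lastMover q f ≡ l
first 0ℙ avoider  = enforcer , refl
first 0ℙ enforcer = avoider , refl
first 1ℙ l        = l , refl

lastMover-injective : ∀ q {f g} → lastMover q f ≡ lastMover q g → f ≡ g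
lastMover-injective 0ℙ {avoider}  {avoider}  _ = refl
lastMover-injective 0ℙ {enforcer} {enforcer} _ = refl
lastMover-injective 1ℙ eq = eq

module Game (H : Hypergraph n) where

  Avoid Enforce : Player → Subset n → Subset n → Set
  Avoid   = WinningStrategy H avoider
  Enforce = WinningStrategy H enforcer

  determined : ∀ m U A → Acc _<_ ∣ U ∣ → Avoid m U A ⊎ Enforce m U A
  determined m U A (acc rs) with nonempty? U
  determined m U A _ | no empty with Any.any? (_⊆? A) (edges H)
  ... | yes won = inj₂ (end empty won)
  ... | no lost = inj₁ (end empty lost)
  determined avoider U A (acc rs) | yes ne
    with search U (λ v v∈U →
           determined enforcer (U - v) (A ∪ ⁅ v ⁆) (rs (x∈p⇒∣p-x∣<∣p∣ v∈U)))
  ... | inj₁ (v , v∈U , s) = inj₁ (move v v∈U s)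
  ... | inj₂ f             = inj₂ (reply ne f)
  determined enforcer U A (acc rs) | yes ne
    with search U (λ v v∈U →
           Sum.swap (determined avoider (U - v) A (rs (x∈p⇒∣p-x∣<∣p∣ v∈U))))
  ... | inj₁ (v , v∈U , s) = inj₂ (move v v∈U s)
  ... | inj₂ f             = inj₁ (reply ne f)

  exclusive : ∀ {m U A} → Avoid m U A → ¬ Enforce m U A
  exclusive (end _ lost)    (end _ won)      = lost won
  exclusive (end empty _)   (move v v∈U _)   = empty (v , v∈U)
  exclusive (end empty _)   (reply ne _)     = empty ne
  exclusive (move v v∈U _)  (end empty _)    = empty (v , v∈U)
  exclusive (reply ne _)    (end empty _)    = empty ne
  exclusive (move v v∈U s)  (reply _ f)      = exclusive s (f v v∈U)
  exclusive (reply _ f)     (move v v∈U s)   = exclusive (f v v∈U) s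

  -- From a position that Avoider wins as last player, he also wins if the
  -- move is passed to him (pass), and if an additional unpicked vertex w is
  -- introduced (spare): he plays as if Enforcer had picked some vertex w.
  pass : ∀ {U A B} → parity ∣ U ∣ ≡ 0ℙ → B ⊆ A →
         Avoid enforcer U A → Avoid avoider U B
  spare : ∀ {m U U′ A B} w → w ∈ U → U′ ≡ U - w →
          lastMover (parity ∣ U′ ∣) m ≡ avoider → B ⊆ A →
          Avoid m U′ A → Avoid m U B

  pass even B⊆A (end empty lost) =
    end empty (lost ∘ Any.map {P = _⊆ _} {Q = _⊆ _} λ e⊆B → B⊆A ∘ e⊆B)
  pass even B⊆A (reply (w , w∈U) f) =
    spare w w∈U refl (alternate enforcer w∈U (even⇒last even)) B⊆A (f w w∈U)

  spare {avoider} w w∈U refl last B⊆A (end empty _) =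
    contradiction empty (odd⇒¬Empty (last⇒odd last))
  spare {avoider} {U} w w∈U refl last B⊆A (move v v∈U-w s) =
    move v (p─q⊆p U ⁅ w ⁆ v∈U-w)
      (spare w (x∈p∧x≢y⇒x∈p-y w∈U (y∈p-x⇒y≢x v∈U-w ∘ sym)) (p─x─y≡p─y─x U w v)
        (alternate avoider v∈U-w last) (∪⁅⁆-mono v B⊆A) s)
  spare {enforcer} {U} {A = A} {B} w w∈U refl last B⊆A s =
    reply (w , w∈U) (answer s)
    where
    answer : Avoid enforcer (U - w) A → ∀ v → v ∈ U → Avoid avoider (U - v) B
    answer s v v∈U with v ≟ w
    answer s           v v∈U | yes refl = pass (last⇒even last) B⊆A s
    answer (end empty _) v v∈U | no v≢w =
      contradiction (v , x∈p∧x≢y⇒x∈p-y v∈U v≢w) empty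
    answer (reply _ f) v v∈U | no v≢w   =
      spare w (x∈p∧x≢y⇒x∈p-y w∈U (v≢w ∘ sym)) (p─x─y≡p─y─x U w v)
        (alternate enforcer v∈U-w last) B⊆A (f v v∈U-w)
      where v∈U-w = x∈p∧x≢y⇒x∈p-y v∈U v≢w

  last⇒second-to-last : WinsAsLast avoider H → WinsAsSecondToLast avoider H
  last⇒second-to-last (enforcer , last , s) =
    avoider , opposite (parity ∣ vertices H ∣) last , pass (last⇒even last) ⊆-refl s
  last⇒second-to-last (avoider , last , end empty _) =
    contradiction empty (odd⇒¬Empty (last⇒odd last))
  last⇒second-to-last (avoider , last , move v v∈V s) =
    enforcer , opposite (parity ∣ vertices H ∣) last ,
    spare v v∈V refl (alternate avoider v∈V last) (p⊆p∪q _) s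

  WinsAs : (p last : Player) → Set
  WinsAs p l = ∃ λ f → lastPlayer H f ≡ l × WinsStarting f p H

  determined-last : ∀ l → WinsAs avoider l ⊎ WinsAs enforcer l
  determined-last l with first (parity ∣ vertices H ∣) l
  ... | f , last = Sum.map (λ s → f , last , s) (λ s → f , last , s)
                           (determined f (vertices H) ⊥ (<-wellFounded _))

  exclusive-last : ∀ {l} → WinsAs avoider l → ¬ WinsAs enforcer l
  exclusive-last (f , eq , s) (g , eq′ , s′)
    with refl ← lastMover-injective (parity ∣ vertices H ∣) {f} {g} (trans eq (sym eq′))
    = exclusive s s′

  unique : ∀ {o o′} → HasOutcome H o → HasOutcome H o′ → o ≡ o′
  unique {𝒜}  {𝒜}  _        _          = refl
  unique {𝒜}  {ℰ}  (a , _)  (_ , e)    = contradiction e (exclusive-last a)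
  unique {𝒜}  {𝒮ℒ} (a , _)  (_ , e)    = contradiction e (exclusive-last a)
  unique {ℰ}  {𝒜}  (_ , e)  (a , _)    = contradiction e (exclusive-last a)
  unique {ℰ}  {ℰ}  _        _          = refl
  unique {ℰ}  {𝒮ℒ} (e , _)  (a , _)    = contradiction e (exclusive-last a)
  unique {𝒮ℒ} {𝒜}  (_ , e)  (a , _)    = contradiction e (exclusive-last a)
  unique {𝒮ℒ} {ℰ}  (a , _)  (e , _)    = contradiction e (exclusive-last a)
  unique {𝒮ℒ} {𝒮ℒ} _        _          = refl

outcome! : (H : Hypergraph n) → ∃! _≡_ (HasOutcome H)
outcome! H = existence (determined-last avoider) (determined-last enforcer)
  where
  open Game H
  existence : WinsAs avoider avoider ⊎ WinsAs enforcer avoider →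
              WinsAs avoider enforcer ⊎ WinsAs enforcer enforcer →
              ∃! _≡_ (HasOutcome H)
  existence (inj₁ a) _         = 𝒜 , h , unique {𝒜} h   where h = a , last⇒second-to-last a
  existence (inj₂ e) (inj₁ a)  = 𝒮ℒ , h , unique {𝒮ℒ} h where h = a , e
  existence (inj₂ e) (inj₂ e′) = ℰ , h , unique {ℰ} h   where h = e′ , e

outcome : Hypergraph n → Outcome
outcome H = proj₁ (outcome! H)

{-# OPTIONS --safe #-}
-- A player combines strategies for the components as follows. If the opponent
-- plays v in a component whose strategy was waiting for the opponent, that
-- strategy simply goes on. If it had prescribed a move w instead, the player
-- answers v by w, which leads where playing w first and then receiving v would
-- have led; if v = w, the opponent has made the undesirable move himself.
-- In this way Avoider combines a component that he wins as last player with any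
-- component that he wins, Enforcer ignores a component in which anything may
-- happen, and two components that Enforcer wins as second-to-last player give
-- him a win as last player. The remaining bookkeeping is the parity of ∣ U ∣.
module Submission where

open import Defs
open import Data.Bool using (true; false)
open import Data.Fin using (_≟_)
open import Data.Fin.Subset
  using (Subset; ⊥; ⁅_⁆; _∈_; _∉_; _⊆_; _∪_; _∩_; _-_; ∣_∣; Empty; Nonempty)
open import Data.Fin.Subset.Properties
  using (nonempty?; drop-∷-Empty; ∪-comm; ∩-comm; p⊆p∪q; q⊆p∪q; x∈p∪q⁻; x∈p∩q⁺;
         p─q⊆p; p─x─y≡p─y─x; x∈⁅y⁆⇒x≡y; x∈p∧x≢y⇒x∈p-y; x∈p⇒∣p-x∣<∣p∣; ⊆-refl)
open import Data.List using (List)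
open import Data.List.Relation.Unary.All as All using (All)
open import Data.List.Relation.Unary.Any as Any using (Any)
import Data.List.Relation.Unary.Any.Properties as Any
open import Data.Nat using (ℕ; suc; _+_; _<_; parity)
open import Data.Nat.Induction using (Acc; acc; <-wellFounded)
open import Data.Nat.Properties using (+-suc)
open import Data.Parity.Base as ℙ using (0ℙ; 1ℙ)
open import Data.Parity.Properties using (+-homo-+)
open import Data.Product using (_×_; _,_; proj₁; proj₂)
open import Data.Sum using (_⊎_; inj₁; inj₂; [_,_]′)
open import Data.Vec using ([]; _∷_; here)
open import Function using (_∘_)
open import Relation.Binary.PropositionalEquality
  using (_≡_; _≢_; refl; sym; trans; cong; subst)
open import Relation.Nullary using (yes; no; contradiction)

private
  variable
    n : ℕ

-- Cardinality of disjoint unions and symmetry of the outcome.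

∣p∪q∣≡∣p∣+∣q∣ : (p q : Subset n) → Empty (p ∩ q) → ∣ p ∪ q ∣ ≡ ∣ p ∣ + ∣ q ∣
∣p∪q∣≡∣p∣+∣q∣ []          []          _ = refl
∣p∪q∣≡∣p∣+∣q∣ (true  ∷ p) (true  ∷ q) e = contradiction (_ , here) e
∣p∪q∣≡∣p∣+∣q∣ (true  ∷ p) (false ∷ q) e =
  cong suc (∣p∪q∣≡∣p∣+∣q∣ p q (drop-∷-Empty e))
∣p∪q∣≡∣p∣+∣q∣ (false ∷ p) (true  ∷ q) e =
  trans (cong suc (∣p∪q∣≡∣p∣+∣q∣ p q (drop-∷-Empty e))) (sym (+-suc ∣ p ∣ ∣ q ∣))
∣p∪q∣≡∣p∣+∣q∣ (false ∷ p) (false ∷ q) e = ∣p∪q∣≡∣p∣+∣q∣ p q (drop-∷-Empty e)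

relabel : ∀ {H H′ : Hypergraph n} {p} → (∀ {A} → WonBy p H A → WonBy p H′ A) →
          ∀ {m U A} → WinningStrategy H p m U A → WinningStrategy H′ p m U A
relabel g (end empty won)  = end empty (g won)
relabel g (move v v∈U s)   = move v v∈U (relabel g s)
relabel g (reply ne f)     = reply ne λ v v∈U → relabel g (f v v∈U)

hasOutcome : (H : Hypergraph n) → HasOutcome H (outcome H)
hasOutcome H = proj₁ (proj₂ (outcome! H))

outcome-unique : (H : Hypergraph n) → ∀ {o} → HasOutcome H o → outcome H ≡ o
outcome-unique H = proj₂ (proj₂ (outcome! H))

-- One direction suffices: every outcome is a pair of wins, so the outcome of `H` also holds of
-- `H′`, and uniqueness does the rest.
outcome-mono : (H H′ : Hypergraph n) →
               (∀ {p l} → Game.WinsAs H p l → Game.WinsAs H′ p l) →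
               outcome H′ ≡ outcome H
outcome-mono H H′ g = outcome-unique H′ (transfer (hasOutcome H))
  where
  transfer : ∀ {o} → HasOutcome H o → HasOutcome H′ o
  transfer {𝒜}  (w , w′) = g w , g w′
  transfer {ℰ}  (w , w′) = g w , g w′
  transfer {𝒮ℒ} (w , w′) = g w , g w′

outcome-∪ᴴ-comm : (H₁ H₂ : Hypergraph n) → outcome (H₁ ∪ᴴ H₂) ≡ outcome (H₂ ∪ᴴ H₁)
outcome-∪ᴴ-comm H₁ H₂ = outcome-mono (H₂ ∪ᴴ H₁) (H₁ ∪ᴴ H₂) wins
  where
  won : ∀ {p A} → WonBy p (H₂ ∪ᴴ H₁) A → WonBy p (H₁ ∪ᴴ H₂) A
  won {avoider}  lost = lost ∘ Any.++-comm (edges H₁) (edges H₂)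
  won {enforcer}      = Any.++-comm (edges H₂) (edges H₁)

  wins : ∀ {p l} → Game.WinsAs (H₂ ∪ᴴ H₁) p l → Game.WinsAs (H₁ ∪ᴴ H₂) p l
  wins {p} {l} (f , last , s) =
    f , subst (λ V → lastMover (parity ∣ V ∣) f ≡ l) V≡ last ,
    subst (λ V → WinningStrategy (H₁ ∪ᴴ H₂) p f V ⊥) V≡ (relabel won s)
    where V≡ = ∪-comm (vertices H₂) (vertices H₁)

-- Comparing the union with its components.

-- The group of order two with identity enforcer: if Avoider would be last in
-- one component with m₁ to move, then who is last does not change when that
-- component is added and m₁ ⊕ m₂ moves instead of m₂.
infixl 6 _⊕_

_⊕_ : Player → Player → Player
enforcer ⊕ m = m
avoider  ⊕ m = opponent m

lastMover-⊕ : ∀ q r {m₁ m₂ l} → lastMover q m₁ ≡ avoider → lastMover r m₂ ≡ l →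
              lastMover (q ℙ.+ r) (m₁ ⊕ m₂) ≡ l
lastMover-⊕ 0ℙ r  {enforcer}            refl refl = refl
lastMover-⊕ 1ℙ 0ℙ {avoider}             refl refl = refl
lastMover-⊕ 1ℙ 1ℙ {avoider} {avoider}   refl refl = refl
lastMover-⊕ 1ℙ 1ℙ {avoider} {enforcer}  refl refl = refl

-- A is what Avoider picked in the union and B what he is imagined to have
-- picked in the component V.
Traces : (V A B : Subset n) → Set
Traces V A B = ∀ {x} → x ∈ V → x ∈ A → x ∈ B

module _ {V A B : Subset n} where

  Traces-pick : ∀ v → Traces V A B → Traces V (A ∪ ⁅ v ⁆) (B ∪ ⁅ v ⁆)
  Traces-pick v t x∈V x∈ with x∈p∪q⁻ A ⁅ v ⁆ x∈
  ... | inj₁ x∈A = p⊆p∪q ⁅ v ⁆ (t x∈V x∈A)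
  ... | inj₂ x∈v = q⊆p∪q B ⁅ v ⁆ x∈v

  Traces-imagine : ∀ v → Traces V A B → Traces V A (B ∪ ⁅ v ⁆)
  Traces-imagine v t x∈V x∈A = p⊆p∪q ⁅ v ⁆ (t x∈V x∈A)

  Traces-outside : ∀ {v} → v ∉ V → Traces V A B → Traces V (A ∪ ⁅ v ⁆) B
  Traces-outside {v} v∉V t x∈V x∈ with x∈p∪q⁻ A ⁅ v ⁆ x∈
  ... | inj₁ x∈A = t x∈V x∈A
  ... | inj₂ x∈v with refl ← x∈⁅y⁆⇒x≡y v x∈v = contradiction x∈V v∉V

-- An edge lies inside the vertex set, where every vertex of `A` is also in `B`.
edge-Traces : ∀ (H : Hypergraph n) {A B} → Traces (vertices H) A B →
              Any (_⊆ A) (edges H) → Any (_⊆ B) (edges H)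
edge-Traces H {A} {B} t = go (edges⊆ H)
  where
  go : ∀ {es} → All (_⊆ vertices H) es → Any (_⊆ A) es → Any (_⊆ B) es
  go (e⊆V All.∷ _) (Any.here e⊆A) = Any.here λ x∈e → t (e⊆V x∈e) (e⊆A x∈e)
  go (_ All.∷ es⊆) (Any.there a)  = Any.there (go es⊆ a)

won-⊆ : ∀ {A B} {es : List (Subset n)} → A ⊆ B → Any (_⊆ A) es → Any (_⊆ B) es
won-⊆ A⊆B = Any.map {P = _⊆ _} {Q = _⊆ _} λ e⊆A → A⊆B ∘ e⊆A

-- The strategy for a component may end while the other component is still in play. As `A` only
-- grows, Enforcer can then move arbitrarily.
Enforce-won : ∀ (H : Hypergraph n) m {U A} → Acc _<_ ∣ U ∣ → Any (_⊆ A) (edges H) →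
              Game.Enforce H m U A
Enforce-won H m {U} _ won with nonempty? U
Enforce-won H m _ won | no empty = end empty won
Enforce-won H avoider (acc rs) won | yes ne =
  reply ne λ v v∈U →
    Enforce-won H enforcer (rs (x∈p⇒∣p-x∣<∣p∣ v∈U)) (won-⊆ (p⊆p∪q ⁅ v ⁆) won)
Enforce-won H enforcer (acc rs) won | yes (v , v∈U) =
  move v v∈U (Enforce-won H avoider (rs (x∈p⇒∣p-x∣<∣p∣ v∈U)) won)

module DisjointUnion (H₁ H₂ : Hypergraph n)
                     (disjoint : Empty (vertices H₁ ∩ vertices H₂)) where

  private
    H  = H₁ ∪ᴴ H₂
    V₁ = vertices H₁
    V₂ = vertices H₂

  open Game H using (Avoid; Enforce)
  open Game H₁ using () renaming (Avoid to Avoid₁; Enforce to Enforce₁)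
  open Game H₂ using () renaming (Avoid to Avoid₂; Enforce to Enforce₂)

  -- Positions of the disjoint union.

  record Split (U U₁ U₂ : Subset n) : Set where
    field
      cover : ∀ {x} → x ∈ U → x ∈ U₁ ⊎ x ∈ U₂
      ⊆U₁   : U₁ ⊆ U
      ⊆U₂   : U₂ ⊆ U
      ⊆V₁   : U₁ ⊆ V₁
      ⊆V₂   : U₂ ⊆ V₂

    ∉V₁ : ∀ {x} → x ∈ U₂ → x ∉ V₁
    ∉V₁ x∈U₂ x∈V₁ = disjoint (_ , x∈p∩q⁺ (x∈V₁ , ⊆V₂ x∈U₂))

    ∉V₂ : ∀ {x} → x ∈ U₁ → x ∉ V₂
    ∉V₂ x∈U₁ x∈V₂ = disjoint (_ , x∈p∩q⁺ (⊆V₁ x∈U₁ , x∈V₂))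

  open Split

  module _ {U U₁ U₂ : Subset n} where

    remove₁ : ∀ {v} → Split U U₁ U₂ → v ∈ U₁ → Split (U - v) (U₁ - v) U₂
    remove₁ {v} σ v∈U₁ .cover x∈ with cover σ (p─q⊆p U ⁅ v ⁆ x∈)
    ... | inj₁ x∈U₁ = inj₁ (x∈p∧x≢y⇒x∈p-y x∈U₁ (y∈p-x⇒y≢x x∈))
    ... | inj₂ x∈U₂ = inj₂ x∈U₂
    remove₁ {v} σ v∈U₁ .⊆U₁ x∈ =
      x∈p∧x≢y⇒x∈p-y (⊆U₁ σ (p─q⊆p U₁ ⁅ v ⁆ x∈)) (y∈p-x⇒y≢x x∈)
    remove₁ {v} σ v∈U₁ .⊆U₂ x∈ =
      x∈p∧x≢y⇒x∈p-y (⊆U₂ σ x∈) λ { refl → ∉V₂ σ v∈U₁ (⊆V₂ σ x∈) }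
    remove₁ {v} σ v∈U₁ .⊆V₁ = ⊆V₁ σ ∘ p─q⊆p U₁ ⁅ v ⁆
    remove₁ {v} σ v∈U₁ .⊆V₂ = ⊆V₂ σ

    remove₂ : ∀ {v} → Split U U₁ U₂ → v ∈ U₂ → Split (U - v) U₁ (U₂ - v)
    remove₂ {v} σ v∈U₂ .cover x∈ with cover σ (p─q⊆p U ⁅ v ⁆ x∈)
    ... | inj₁ x∈U₁ = inj₁ x∈U₁
    ... | inj₂ x∈U₂ = inj₂ (x∈p∧x≢y⇒x∈p-y x∈U₂ (y∈p-x⇒y≢x x∈))
    remove₂ {v} σ v∈U₂ .⊆U₁ x∈ =
      x∈p∧x≢y⇒x∈p-y (⊆U₁ σ x∈) λ { refl → ∉V₁ σ v∈U₂ (⊆V₁ σ x∈) }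
    remove₂ {v} σ v∈U₂ .⊆U₂ x∈ =
      x∈p∧x≢y⇒x∈p-y (⊆U₂ σ (p─q⊆p U₂ ⁅ v ⁆ x∈)) (y∈p-x⇒y≢x x∈)
    remove₂ {v} σ v∈U₂ .⊆V₁ = ⊆V₁ σ
    remove₂ {v} σ v∈U₂ .⊆V₂ = ⊆V₂ σ ∘ p─q⊆p U₂ ⁅ v ⁆

  module _ {U U₁ U₂ : Subset n} where

    -- The players really pick `v` and then `w`, whereas the component strategy sees `w` first.
    remove₁² : ∀ {v w} → Split U U₁ U₂ → v ∈ U₁ → w ∈ U₁ → v ≢ w →
               Split (U - v - w) (U₁ - w - v) U₂
    remove₁² {v} {w} σ v∈ w∈ v≢w =
      subst (λ X → Split (U - v - w) X U₂) (p─x─y≡p─y─x U₁ v w)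
        (remove₁ (remove₁ σ v∈) (x∈p∧x≢y⇒x∈p-y w∈ (v≢w ∘ sym)))

    remove₂² : ∀ {v w} → Split U U₁ U₂ → v ∈ U₂ → w ∈ U₂ → v ≢ w →
               Split (U - v - w) U₁ (U₂ - w - v)
    remove₂² {v} {w} σ v∈ w∈ v≢w =
      subst (λ X → Split (U - v - w) U₁ X) (p─x─y≡p─y─x U₂ v w)
        (remove₂ (remove₂ σ v∈) (x∈p∧x≢y⇒x∈p-y w∈ (v≢w ∘ sym)))

    empty-∪ : Split U U₁ U₂ → Empty U₁ → Empty U₂ → Empty U
    empty-∪ σ e₁ e₂ (x , x∈U) =
      [ (λ x∈U₁ → e₁ (x , x∈U₁)) , (λ x∈U₂ → e₂ (x , x∈U₂)) ]′ (cover σ x∈U)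

  split : Split (V₁ ∪ V₂) V₁ V₂
  split .cover = x∈p∪q⁻ V₁ V₂
  split .⊆U₁   = p⊆p∪q V₂
  split .⊆U₂   = q⊆p∪q V₁ V₂
  split .⊆V₁   = ⊆-refl
  split .⊆V₂   = ⊆-refl

  lost-∪ : ∀ {A A₁ A₂} → Traces V₁ A A₁ → Traces V₂ A A₂ →
           WonBy avoider H₁ A₁ → WonBy avoider H₂ A₂ → WonBy avoider H A
  lost-∪ t₁ t₂ l₁ l₂ a with Any.++⁻ (edges H₁) a
  ... | inj₁ a₁ = l₁ (edge-Traces H₁ t₁ a₁)
  ... | inj₂ a₂ = l₂ (edge-Traces H₂ t₂ a₂)

  won₁ : ∀ {A A₁} → A₁ ⊆ A → WonBy enforcer H₁ A₁ → WonBy enforcer H A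
  won₁ A₁⊆A = Any.++⁺ˡ ∘ won-⊆ A₁⊆A

  won₂ : ∀ {A A₂} → A₂ ⊆ A → WonBy enforcer H₂ A₂ → WonBy enforcer H A
  won₂ A₂⊆A = Any.++⁺ʳ (edges H₁) ∘ won-⊆ A₂⊆A

  -- Avoider's strategy on the union.

  avoid-rest : ∀ {m U U₁ U₂ A A₁ A₂} → Split U U₁ U₂ → Traces V₁ A A₁ → Traces V₂ A A₂ →
               Empty U₂ → WonBy avoider H₂ A₂ → Avoid₁ m U₁ A₁ → Avoid m U A
  avoid-rest σ t₁ t₂ e₂ l₂ (end e₁ l₁) = end (empty-∪ σ e₁ e₂) (lost-∪ t₁ t₂ l₁ l₂)
  avoid-rest σ t₁ t₂ e₂ l₂ (move v v∈U₁ s) =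
    move v (⊆U₁ σ v∈U₁)
      (avoid-rest (remove₁ σ v∈U₁) (Traces-pick v t₁) (Traces-outside (∉V₂ σ v∈U₁) t₂)
        e₂ l₂ s)
  avoid-rest σ t₁ t₂ e₂ l₂ (reply (w , w∈U₁) f) =
    reply (w , ⊆U₁ σ w∈U₁) λ v v∈U → answer v (cover σ v∈U)
    where
    answer : ∀ v → _ ⊎ _ → _
    answer v (inj₁ v∈U₁) = avoid-rest (remove₁ σ v∈U₁) t₁ t₂ e₂ l₂ (f v v∈U₁)
    answer v (inj₂ v∈U₂) = contradiction (v , v∈U₂) e₂

  -- Avoider is to move in the union exactly when `m₁` and `m₂` differ, so one component strategy
  -- expects a move from him and he makes it. If that component is `H₁`, it cannot be exhausted, as
  -- `∣ U₁ ∣` is then odd.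
  avoid-∪ : ∀ {m₁ m₂ U U₁ U₂ A A₁ A₂} → Split U U₁ U₂ →
            Traces V₁ A A₁ → Traces V₂ A A₂ →
            lastMover (parity ∣ U₁ ∣) m₁ ≡ avoider →
            Avoid₁ m₁ U₁ A₁ → Avoid₂ m₂ U₂ A₂ → Avoid (m₁ ⊕ m₂) U A

  -- Enforcer moves in the union exactly when the same player is to move in both components; hence
  -- the single `m`.
  avoid-respond₁ : ∀ {m U U₁ U₂ A A₁ A₂ v} → Split U U₁ U₂ →
                   Traces V₁ A A₁ → Traces V₂ A A₂ →
                   lastMover (parity ∣ U₁ ∣) m ≡ avoider →
                   Avoid₁ m U₁ A₁ → Avoid₂ m U₂ A₂ → v ∈ U₁ → Avoid avoider (U - v) A
  avoid-respond₂ : ∀ {m U U₁ U₂ A A₁ A₂ v} → Split U U₁ U₂ →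
                   Traces V₁ A A₁ → Traces V₂ A A₂ →
                   lastMover (parity ∣ U₁ ∣) m ≡ avoider →
                   Avoid₁ m U₁ A₁ → Avoid₂ m U₂ A₂ → v ∈ U₂ → Avoid avoider (U - v) A

  avoid-∪ {avoider} σ t₁ t₂ last (end e₁ _) s₂ =
    contradiction e₁ (odd⇒¬Empty (last⇒odd last))
  avoid-∪ {avoider} {enforcer} σ t₁ t₂ last (move w w∈U₁ s₁) s₂ =
    move w (⊆U₁ σ w∈U₁)
      (avoid-∪ (remove₁ σ w∈U₁) (Traces-pick w t₁) (Traces-outside (∉V₂ σ w∈U₁) t₂)
        (alternate avoider w∈U₁ last) s₁ s₂)
  avoid-∪ {avoider} {avoider} σ t₁ t₂ last s₁@(move w w∈U₁ _) s₂ =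
    reply (w , ⊆U₁ σ w∈U₁) λ v v∈U →
      [ avoid-respond₁ σ t₁ t₂ last s₁ s₂ , avoid-respond₂ σ t₁ t₂ last s₁ s₂ ]′
      (cover σ v∈U)
  -- Avoider must move, but `H₂` is exhausted and `H₁` expects Enforcer. Being last in `H₁`, Avoider
  -- can take the turn there, and only `H₁` remains to be played.
  avoid-∪ {enforcer} {avoider} σ t₁ t₂ last s₁ (end e₂ l₂) =
    avoid-rest σ t₁ t₂ e₂ l₂ (Game.pass H₁ (last⇒even last) ⊆-refl s₁)
  avoid-∪ {enforcer} {avoider} σ t₁ t₂ last s₁ (move w w∈U₂ s₂) =
    move w (⊆U₂ σ w∈U₂)
      (avoid-∪ (remove₂ σ w∈U₂) (Traces-outside (∉V₁ σ w∈U₂) t₁) (Traces-pick w t₂)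
        last s₁ s₂)
  avoid-∪ {enforcer} {enforcer} σ t₁ t₂ last (end e₁ l₁) (end e₂ l₂) =
    end (empty-∪ σ e₁ e₂) (lost-∪ t₁ t₂ l₁ l₂)
  avoid-∪ {enforcer} {enforcer} σ t₁ t₂ last s₁@(reply (w , w∈U₁) _) s₂ =
    reply (w , ⊆U₁ σ w∈U₁) λ v v∈U →
      [ avoid-respond₁ σ t₁ t₂ last s₁ s₂ , avoid-respond₂ σ t₁ t₂ last s₁ s₂ ]′
      (cover σ v∈U)
  avoid-∪ {enforcer} {enforcer} σ t₁ t₂ last s₁ s₂@(reply (w , w∈U₂) _) =
    reply (w , ⊆U₂ σ w∈U₂) λ v v∈U →
      [ avoid-respond₁ σ t₁ t₂ last s₁ s₂ , avoid-respond₂ σ t₁ t₂ last s₁ s₂ ]′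
      (cover σ v∈U)

  avoid-respond₁ σ t₁ t₂ last (end e _) s₂ v∈U₁ = contradiction (_ , v∈U₁) e
  avoid-respond₁ σ t₁ t₂ last (reply _ f) s₂ v∈U₁ =
    avoid-∪ (remove₁ σ v∈U₁) t₁ t₂ (alternate enforcer v∈U₁ last) (f _ v∈U₁) s₂
  avoid-respond₁ {v = v} σ t₁ t₂ last (move w w∈U₁ s) s₂ v∈U₁ with v ≟ w
  -- Enforcer picked `w`, but the imagined position credits it to Avoider. This is harmless, since
  -- Avoider's real set may be smaller than the imagined one.
  avoid-respond₁ σ t₁ t₂ last (move w w∈U₁ s) s₂ v∈U₁ | yes refl =
    avoid-∪ (remove₁ σ v∈U₁) (Traces-imagine w t₁) t₂ (alternate avoider v∈U₁ last) s s₂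
  avoid-respond₁ σ t₁ t₂ last (move w w∈U₁ (end e _)) s₂ v∈U₁ | no v≢w =
    contradiction (_ , x∈p∧x≢y⇒x∈p-y v∈U₁ v≢w) e
  avoid-respond₁ σ t₁ t₂ last (move w w∈U₁ (reply _ f)) s₂ v∈U₁ | no v≢w =
    move w (x∈p∧x≢y⇒x∈p-y (⊆U₁ σ w∈U₁) (v≢w ∘ sym))
      (avoid-∪ (remove₁² σ v∈U₁ w∈U₁ v≢w) (Traces-pick w t₁)
        (Traces-outside (∉V₂ σ w∈U₁) t₂)
        (alternate enforcer v∈U₁-w (alternate avoider w∈U₁ last)) (f _ v∈U₁-w) s₂)
    where v∈U₁-w = x∈p∧x≢y⇒x∈p-y v∈U₁ v≢w

  avoid-respond₂ σ t₁ t₂ last s₁ (end e _) v∈U₂ = contradiction (_ , v∈U₂) e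
  avoid-respond₂ {enforcer} σ t₁ t₂ last s₁ (reply _ f) v∈U₂ =
    avoid-∪ (remove₂ σ v∈U₂) t₁ t₂ last s₁ (f _ v∈U₂)
  avoid-respond₂ {v = v} σ t₁ t₂ last s₁ (move w w∈U₂ s) v∈U₂ with v ≟ w
  avoid-respond₂ σ t₁ t₂ last s₁ (move w w∈U₂ s) v∈U₂ | yes refl =
    avoid-∪ (remove₂ σ v∈U₂) t₁ (Traces-imagine w t₂) last s₁ s
  avoid-respond₂ σ t₁ t₂ last s₁ (move w w∈U₂ (end e _)) v∈U₂ | no v≢w =
    contradiction (_ , x∈p∧x≢y⇒x∈p-y v∈U₂ v≢w) e
  avoid-respond₂ σ t₁ t₂ last s₁ (move w w∈U₂ (reply _ f)) v∈U₂ | no v≢w =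
    move w (x∈p∧x≢y⇒x∈p-y (⊆U₂ σ w∈U₂) (v≢w ∘ sym))
      (avoid-∪ (remove₂² σ v∈U₂ w∈U₂ v≢w) (Traces-outside (∉V₁ σ w∈U₂) t₁)
        (Traces-pick w t₂) last s₁ (f _ (x∈p∧x≢y⇒x∈p-y v∈U₂ v≢w)))

  -- Enforcer plays for one component only.

  -- No strategy is followed in `H₁`: `m₁` merely encodes a parity, being `avoider` when `∣ U₁ ∣` is
  -- odd and `enforcer` when it is even. Moves in `U₁` descend in no strategy tree, hence the
  -- recursion on `Acc`.
  enforce-spare : ∀ {m₁ m₂ U U₁ U₂ A A₂} → Acc _<_ ∣ U₁ ∣ → Split U U₁ U₂ → A₂ ⊆ A →
                  lastMover (parity ∣ U₁ ∣) m₁ ≡ avoider →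
                  Enforce₂ m₂ U₂ A₂ → Enforce (m₁ ⊕ m₂) U A
  -- Avoider moves in the union exactly when `m₁` and `m₂` differ; hence `opponent m`.
  enforce-spare-respond : ∀ {m U U₁ U₂ A A₂ v} → Acc _<_ ∣ U₁ ∣ → Split U U₁ U₂ → A₂ ⊆ A →
                          lastMover (parity ∣ U₁ ∣) m ≡ avoider →
                          Enforce₂ (opponent m) U₂ A₂ → v ∈ U₁ ⊎ v ∈ U₂ →
                          Enforce enforcer (U - v) (A ∪ ⁅ v ⁆)

  enforce-spare _ σ A₂⊆A last (end _ won) =
    Enforce-won H _ (<-wellFounded _) (won₂ A₂⊆A won)
  enforce-spare {enforcer} {enforcer} a σ A₂⊆A last (move w w∈U₂ s) =
    move w (⊆U₂ σ w∈U₂) (enforce-spare a (remove₂ σ w∈U₂) A₂⊆A last s)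
  enforce-spare {enforcer} {avoider} a σ A₂⊆A last s@(reply (w , w∈U₂) _) =
    reply (w , ⊆U₂ σ w∈U₂) λ v v∈U →
      enforce-spare-respond a σ A₂⊆A last s (cover σ v∈U)
  enforce-spare {avoider} {enforcer} a σ A₂⊆A last s@(move w w∈U₂ _) =
    reply (w , ⊆U₂ σ w∈U₂) λ v v∈U →
      enforce-spare-respond a σ A₂⊆A last s (cover σ v∈U)
  -- `H₂` waits for Avoider, so Enforcer spends a move in `H₁`, where one is left because `∣ U₁ ∣`
  -- is odd.
  enforce-spare {avoider} {avoider} {U₁ = U₁} (acc rs) σ A₂⊆A last s with nonempty? U₁
  ... | no e = contradiction e (odd⇒¬Empty (last⇒odd last))
  ... | yes (w , w∈U₁) =
    move w (⊆U₁ σ w∈U₁)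
      (enforce-spare (rs (x∈p⇒∣p-x∣<∣p∣ w∈U₁)) (remove₁ σ w∈U₁) A₂⊆A
        (alternate avoider w∈U₁ last) s)

  enforce-spare-respond {enforcer} (acc rs) σ A₂⊆A last s (inj₁ v∈U₁) =
    enforce-spare (rs (x∈p⇒∣p-x∣<∣p∣ v∈U₁)) (remove₁ σ v∈U₁) (p⊆p∪q _ ∘ A₂⊆A)
      (alternate enforcer v∈U₁ last) s
  enforce-spare-respond {avoider} (acc rs) σ A₂⊆A last s (inj₁ v∈U₁) =
    enforce-spare (rs (x∈p⇒∣p-x∣<∣p∣ v∈U₁)) (remove₁ σ v∈U₁) (p⊆p∪q _ ∘ A₂⊆A)
      (alternate avoider v∈U₁ last) s
  enforce-spare-respond a σ A₂⊆A last (end e _) (inj₂ v∈U₂) = contradiction (_ , v∈U₂) e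
  enforce-spare-respond {enforcer} a σ A₂⊆A last (reply _ f) (inj₂ v∈U₂) =
    enforce-spare a (remove₂ σ v∈U₂) (∪⁅⁆-mono _ A₂⊆A) last (f _ v∈U₂)
  enforce-spare-respond {avoider} {v = v} a σ A₂⊆A last (move w w∈U₂ s) (inj₂ v∈U₂)
    with v ≟ w
  -- Avoider took the vertex meant for Enforcer; his real set may exceed the imagined `A₂`.
  enforce-spare-respond {avoider} a σ A₂⊆A last (move w w∈U₂ s) (inj₂ v∈U₂) | yes refl =
    enforce-spare a (remove₂ σ v∈U₂) (p⊆p∪q _ ∘ A₂⊆A) last s
  enforce-spare-respond {avoider} a σ A₂⊆A last (move w w∈U₂ (end e _)) (inj₂ v∈U₂)
    | no v≢w = contradiction (_ , x∈p∧x≢y⇒x∈p-y v∈U₂ v≢w) e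
  enforce-spare-respond {avoider} a σ A₂⊆A last (move w w∈U₂ (reply _ f)) (inj₂ v∈U₂)
    | no v≢w =
    move w (x∈p∧x≢y⇒x∈p-y (⊆U₂ σ w∈U₂) (v≢w ∘ sym))
      (enforce-spare a (remove₂² σ v∈U₂ w∈U₂ v≢w) (∪⁅⁆-mono _ A₂⊆A) last
        (f _ (x∈p∧x≢y⇒x∈p-y v∈U₂ v≢w)))

  -- Enforcer plays for both components.

  -- With `opponent`, Enforcer is to move exactly when `m₁` and `m₂` differ, so one component
  -- strategy offers him a move, and a strategy that has ended comes with a completed edge.
  enforce-both : ∀ {m₁ m₂ U U₁ U₂ A A₁ A₂} → Split U U₁ U₂ → A₁ ⊆ A → A₂ ⊆ A →
                 Enforce₁ m₁ U₁ A₁ → Enforce₂ m₂ U₂ A₂ →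
                 Enforce (opponent (m₁ ⊕ m₂)) U A
  enforce-both-respond₁ : ∀ {m U U₁ U₂ A A₁ A₂ v} → Split U U₁ U₂ → A₁ ⊆ A → A₂ ⊆ A →
                          Enforce₁ m U₁ A₁ → Enforce₂ m U₂ A₂ → v ∈ U₁ →
                          Enforce enforcer (U - v) (A ∪ ⁅ v ⁆)
  enforce-both-respond₂ : ∀ {m U U₁ U₂ A A₁ A₂ v} → Split U U₁ U₂ → A₁ ⊆ A → A₂ ⊆ A →
                          Enforce₁ m U₁ A₁ → Enforce₂ m U₂ A₂ → v ∈ U₂ →
                          Enforce enforcer (U - v) (A ∪ ⁅ v ⁆)

  enforce-both σ A₁⊆A A₂⊆A (end _ won) s₂ =
    Enforce-won H _ (<-wellFounded _) (won₁ A₁⊆A won)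
  enforce-both σ A₁⊆A A₂⊆A s₁ (end _ won) =
    Enforce-won H _ (<-wellFounded _) (won₂ A₂⊆A won)
  enforce-both {enforcer} {avoider} σ A₁⊆A A₂⊆A (move w w∈U₁ s₁) s₂ =
    move w (⊆U₁ σ w∈U₁) (enforce-both (remove₁ σ w∈U₁) A₁⊆A A₂⊆A s₁ s₂)
  enforce-both {avoider} {enforcer} σ A₁⊆A A₂⊆A s₁ (move w w∈U₂ s₂) =
    move w (⊆U₂ σ w∈U₂) (enforce-both (remove₂ σ w∈U₂) A₁⊆A A₂⊆A s₁ s₂)
  enforce-both {enforcer} {enforcer} σ A₁⊆A A₂⊆A s₁@(move w w∈U₁ _) s₂ =
    reply (w , ⊆U₁ σ w∈U₁) λ v v∈U →
      [ enforce-both-respond₁ σ A₁⊆A A₂⊆A s₁ s₂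
      , enforce-both-respond₂ σ A₁⊆A A₂⊆A s₁ s₂ ]′ (cover σ v∈U)
  enforce-both {avoider} {avoider} σ A₁⊆A A₂⊆A s₁@(reply (w , w∈U₁) _) s₂ =
    reply (w , ⊆U₁ σ w∈U₁) λ v v∈U →
      [ enforce-both-respond₁ σ A₁⊆A A₂⊆A s₁ s₂
      , enforce-both-respond₂ σ A₁⊆A A₂⊆A s₁ s₂ ]′ (cover σ v∈U)

  enforce-both-respond₁ σ A₁⊆A A₂⊆A (end e _) s₂ v∈U₁ = contradiction (_ , v∈U₁) e
  enforce-both-respond₁ σ A₁⊆A A₂⊆A (reply _ f) s₂ v∈U₁ =
    enforce-both (remove₁ σ v∈U₁) (∪⁅⁆-mono _ A₁⊆A) (p⊆p∪q _ ∘ A₂⊆A) (f _ v∈U₁) s₂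
  enforce-both-respond₁ {v = v} σ A₁⊆A A₂⊆A (move w w∈U₁ s) s₂ v∈U₁ with v ≟ w
  enforce-both-respond₁ σ A₁⊆A A₂⊆A (move w w∈U₁ s) s₂ v∈U₁ | yes refl =
    enforce-both (remove₁ σ v∈U₁) (p⊆p∪q _ ∘ A₁⊆A) (p⊆p∪q _ ∘ A₂⊆A) s s₂
  enforce-both-respond₁ σ A₁⊆A A₂⊆A (move w w∈U₁ (end e _)) s₂ v∈U₁ | no v≢w =
    contradiction (_ , x∈p∧x≢y⇒x∈p-y v∈U₁ v≢w) e
  enforce-both-respond₁ σ A₁⊆A A₂⊆A (move w w∈U₁ (reply _ f)) s₂ v∈U₁ | no v≢w =
    move w (x∈p∧x≢y⇒x∈p-y (⊆U₁ σ w∈U₁) (v≢w ∘ sym))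
      (enforce-both (remove₁² σ v∈U₁ w∈U₁ v≢w) (∪⁅⁆-mono _ A₁⊆A) (p⊆p∪q _ ∘ A₂⊆A)
        (f _ (x∈p∧x≢y⇒x∈p-y v∈U₁ v≢w)) s₂)

  enforce-both-respond₂ σ A₁⊆A A₂⊆A s₁ (end e _) v∈U₂ = contradiction (_ , v∈U₂) e
  enforce-both-respond₂ {avoider} σ A₁⊆A A₂⊆A s₁ (reply _ f) v∈U₂ =
    enforce-both (remove₂ σ v∈U₂) (p⊆p∪q _ ∘ A₁⊆A) (∪⁅⁆-mono _ A₂⊆A) s₁ (f _ v∈U₂)
  enforce-both-respond₂ {v = v} σ A₁⊆A A₂⊆A s₁ (move w w∈U₂ s) v∈U₂ with v ≟ w
  enforce-both-respond₂ σ A₁⊆A A₂⊆A s₁ (move w w∈U₂ s) v∈U₂ | yes refl =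
    enforce-both (remove₂ σ v∈U₂) (p⊆p∪q _ ∘ A₁⊆A) (p⊆p∪q _ ∘ A₂⊆A) s₁ s
  enforce-both-respond₂ σ A₁⊆A A₂⊆A s₁ (move w w∈U₂ (end e _)) v∈U₂ | no v≢w =
    contradiction (_ , x∈p∧x≢y⇒x∈p-y v∈U₂ v≢w) e
  enforce-both-respond₂ σ A₁⊆A A₂⊆A s₁ (move w w∈U₂ (reply _ f)) v∈U₂ | no v≢w =
    move w (x∈p∧x≢y⇒x∈p-y (⊆U₂ σ w∈U₂) (v≢w ∘ sym))
      (enforce-both (remove₂² σ v∈U₂ w∈U₂ v≢w) (p⊆p∪q _ ∘ A₁⊆A) (∪⁅⁆-mono _ A₂⊆A)
        s₁ (f _ (x∈p∧x≢y⇒x∈p-y v∈U₂ v≢w)))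

  -- Outcomes of the union.

  open Game using (WinsAs)

  -- Disjointness makes the sizes, and so the parities, add up.
  lastPlayer-∪ : ∀ {m₁ m₂ l} → lastPlayer H₁ m₁ ≡ avoider → lastPlayer H₂ m₂ ≡ l →
                 lastPlayer H (m₁ ⊕ m₂) ≡ l
  lastPlayer-∪ {m₁} {m₂} {l} last₁ last₂ =
    subst (λ q → lastMover q (m₁ ⊕ m₂) ≡ l)
      (sym (trans (cong parity (∣p∪q∣≡∣p∣+∣q∣ V₁ V₂ disjoint)) (+-homo-+ ∣ V₁ ∣ ∣ V₂ ∣)))
      (lastMover-⊕ (parity ∣ V₁ ∣) (parity ∣ V₂ ∣) last₁ last₂)

  avoider-wins-∪ : ∀ {l} → WinsAs H₁ avoider avoider → WinsAs H₂ avoider l →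
                   WinsAs H avoider l
  avoider-wins-∪ (m₁ , last₁ , s₁) (m₂ , last₂ , s₂) =
    m₁ ⊕ m₂ , lastPlayer-∪ last₁ last₂ ,
    avoid-∪ split (λ _ x∈ → x∈) (λ _ x∈ → x∈) last₁ s₁ s₂

  enforcer-wins-∪ : ∀ {l} → WinsAs H₂ enforcer l → WinsAs H enforcer l
  enforcer-wins-∪ (m₂ , last₂ , s₂) with first (parity ∣ V₁ ∣) avoider
  ... | m₁ , last₁ =
    m₁ ⊕ m₂ , lastPlayer-∪ last₁ last₂ ,
    enforce-spare (<-wellFounded _) split ⊆-refl last₁ s₂

  -- Avoider would be last if `m₁ ⊕ m₂` started; `enforce-both` has the other player start.
  enforcer-wins-both : WinsAs H₁ enforcer avoider → WinsAs H₂ enforcer avoider →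
                       WinsAs H enforcer enforcer
  enforcer-wins-both (m₁ , last₁ , s₁) (m₂ , last₂ , s₂) =
    opponent (m₁ ⊕ m₂) ,
    opposite (parity ∣ vertices H ∣) (lastPlayer-∪ last₁ last₂) ,
    enforce-both split ⊆-refl ⊆-refl s₁ s₂

  -- Each win on `H₂` carries over with the same last player: Avoider's by combining it with his win
  -- as last player on `H₁`, Enforcer's by ignoring `H₁`.
  𝒜-∪ : ∀ {o} → HasOutcome H₁ 𝒜 → HasOutcome H₂ o → HasOutcome H o
  𝒜-∪ {𝒜}  (a₁ , _) (a , a′) = avoider-wins-∪ a₁ a , avoider-wins-∪ a₁ a′
  𝒜-∪ {ℰ}  _        (e , e′) = enforcer-wins-∪ e , enforcer-wins-∪ e′
  𝒜-∪ {𝒮ℒ} (a₁ , _) (a , e)  = avoider-wins-∪ a₁ a , enforcer-wins-∪ e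

  𝒮ℒ-∪ : HasOutcome H₁ 𝒮ℒ → HasOutcome H₂ 𝒮ℒ → HasOutcome H ℰ
  𝒮ℒ-∪ (_ , e₁) (_ , e₂) = enforcer-wins-both e₁ e₂ , enforcer-wins-∪ e₂

  ℰ-∪ : HasOutcome H₂ ℰ → HasOutcome H ℰ
  ℰ-∪ (e , e′) = enforcer-wins-∪ e , enforcer-wins-∪ e′

  outcome-𝒜-∪ : outcome H₁ ≡ 𝒜 → outcome H ≡ outcome H₂
  outcome-𝒜-∪ eq =
    outcome-unique H (𝒜-∪ (subst (HasOutcome H₁) eq (hasOutcome H₁)) (hasOutcome H₂))

  outcome-𝒮ℒ-∪ : outcome H₁ ≡ 𝒮ℒ → outcome H₂ ≡ 𝒮ℒ → outcome H ≡ ℰ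
  outcome-𝒮ℒ-∪ eq₁ eq₂ =
    outcome-unique H (𝒮ℒ-∪ (subst (HasOutcome H₁) eq₁ (hasOutcome H₁))
                           (subst (HasOutcome H₂) eq₂ (hasOutcome H₂)))

  outcome-ℰ-∪ : outcome H₂ ≡ ℰ → outcome H ≡ ℰ
  outcome-ℰ-∪ eq = outcome-unique H (ℰ-∪ (subst (HasOutcome H₂) eq (hasOutcome H₂)))

theorem2p6 : (n : ℕ) (H₁ H₂ : Hypergraph n) →
    Empty (vertices H₁ ∩ vertices H₂) →
    (outcome H₁ ≡ 𝒜 → outcome (H₁ ∪ᴴ H₂) ≡ outcome H₂) ×
    (outcome H₂ ≡ 𝒜 → outcome (H₁ ∪ᴴ H₂) ≡ outcome H₁) ×
    (outcome H₁ ≡ 𝒮ℒ → outcome H₂ ≡ 𝒮ℒ → outcome (H₁ ∪ᴴ H₂) ≡ ℰ) ×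
    (outcome H₁ ≡ ℰ ⊎ outcome H₂ ≡ ℰ → outcome (H₁ ∪ᴴ H₂) ≡ ℰ)
theorem2p6 n H₁ H₂ disjoint =
  -- The second claim and the case `outcome H₁ ≡ ℰ` come from exchanging the components.
  H₁∪H₂.outcome-𝒜-∪ , trans comm ∘ H₂∪H₁.outcome-𝒜-∪ , H₁∪H₂.outcome-𝒮ℒ-∪ ,
  [ trans comm ∘ H₂∪H₁.outcome-ℰ-∪ , H₁∪H₂.outcome-ℰ-∪ ]′
  where
  module H₁∪H₂ = DisjointUnion H₁ H₂ disjoint
  module H₂∪H₁ = DisjointUnion H₂ H₁ (disjoint ∘ subst Nonempty (∩-comm _ _))
  comm = outcome-∪ᴴ-comm H₁ H₂
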